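{- Let $k,l$ be positive integers and put $a=3k-2$, $b=3l-2$. For every cell $c$ of the Aztec rectangle $\mathcal{AR}_{a,b}$, the region $\mathcal{AR}_{a,b}$ with the single defect $c$ has a cover by L-trominoes, i.e. $\mathcal{AR}_{a,b}\setminus\{c\}$ can be partitioned into L-trominoes.
   Context: A cell is a unit square $[i,i+1]\times[j,j+1]$ with $i,j\in\mathbb{Z}$, labelled $(i,j)$. An L-tromino is a set of three cells equal to a $2\times 2$ block of cells with one cell removed. A defect is a cell of a region that must not be covered. A cover of a region $R$ with defect set $D$ is a set of pairwise disjoint L-trominoes, each contained in $R\setminus D$, whose union is $R\setminus D$. For positive integers $a,b$, the Aztec rectangle $\mathcal{AR}_{a,b}$ is (up to translation) the region consisting of the cells $(i,j)\in\mathbb{Z}^2$ with $0\le i+j\le 2b$ and $1\le j-i\le 2a+1$; it has $a$ cells along its southwestern side and $b$ cells along its northwestern side. -}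

module Defs where

open import Level using (0ℓ)
open import Data.Integer using (ℤ; +_; _+_; _-_; _≤_; 0ℤ; 1ℤ)
open import Data.List using (List)
open import Data.List.Relation.Unary.All using (All)
open import Data.List.Relation.Unary.AllPairs using (AllPairs)
open import Data.List.Relation.Unary.Any using (Any)
open import Data.Nat as ℕ using (ℕ)
open import Data.Product using (_×_; _,_; ∃-syntax)
open import Data.Sum using (_⊎_)
open import Relation.Binary.PropositionalEquality using (_≡_)
open import Relation.Unary using (Pred; _∈_; _⊆_; _≐_; _⊥_; _∖_; ｛_｝)

-- The pair (i , j) stands for the unit square [i, i+1] × [j, j+1].
Cell : Set
Cell = ℤ × ℤ

Region : Set₁
Region = Pred Cell 0ℓ

block : Cell → Region
block (i , j) (x , y) = (x ≡ i ⊎ x ≡ i + 1ℤ) × (y ≡ j ⊎ y ≡ j + 1ℤ)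

record LTromino : Set where
  field
    corner        : Cell
    removed       : Cell
    removed∈block : removed ∈ block corner

  cells : Region
  cells = block corner ∖ ｛ removed ｝

open LTromino public using (cells)

union : List LTromino → Region
union T c = Any (λ t → c ∈ cells t) T

-- A set of trominoes is given as a list: bounded regions only have finite
-- covers, and pairwise disjointness rules out repeated entries because
-- trominoes are nonempty.
record IsCover (R D : Region) (T : List LTromino) : Set where
  field
    disjoint  : AllPairs (λ s t → cells s ⊥ cells t) T
    contained : All (λ t → cells t ⊆ R ∖ D) T
    covers    : union T ≐ R ∖ D

HasCover : Region → Region → Set
HasCover R D = ∃[ T ] IsCover R D T

AztecRectangle : ℕ → ℕ → Region
AztecRectangle a b (i , j) =
  (0ℤ ≤ i + j × i + j ≤ + (2 ℕ.* b)) ×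
  (1ℤ ≤ j - i × j - i ≤ + (2 ℕ.* a ℕ.+ 1))

{-# OPTIONS --safe #-}

-- Write u = i + j and v = j - i.  The only cells are the lattice points (u , v)
-- with u ≡ v (mod 2), and a box of size 3 × 2 or 2 × 3 in the (u , v)-plane
-- contains three of them, which form an L-tromino whatever the parity of its
-- corner.  A 3 × 3 box whose corner has odd u + v is a 2 × 2 block of cells, so
-- it is an L-tromino once any of its cells is removed.  AR_{a,b} is the box
-- [0, 2b] × [1, 2a+1], and 2b+1 is an odd multiple of 3.  Hence the defect lies
-- in a 3 × 3 box with even u and odd v at its corner; the rest of the three rows
-- of that box is cut into 2 × 3 boxes, and the rows below and above come in
-- pairs, which are cut into 3 × 2 boxes.
module Submission where

open import Defs
open import Data.Fin as Fin using (toℕ; fromℕ<; _↑ˡ_; _↑ʳ_)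
open import Data.Fin.Patterns using (0F; 1F; 2F)
open import Data.Fin.Properties
  using (toℕ<n; toℕ-fromℕ<; toℕ-↑ˡ; toℕ-↑ʳ; splitAt⁻¹-↑ˡ; splitAt⁻¹-↑ʳ)
open import Data.Integer as ℤ using (ℤ; +_; 0ℤ; 1ℤ; +≤+)
open import Data.Integer.DivMod using (_/ℕ_; _%ℕ_; n%ℕd<d; a≡a%ℕn+[a/ℕn]*n)
import Data.Integer.Properties as ℤ
open import Algebra.Properties.AbelianGroup ℤ.+-0-abelianGroup using (∙-cancelˡ; ∙-cancelʳ)
open import Data.Integer.Tactic.RingSolver using (solve-∀)
open import Data.List using ([]; _∷_; _++_)
open import Data.List.Membership.Propositional using (lose)
open import Data.List.Relation.Unary.All as All using ([])
open import Data.List.Relation.Unary.AllPairs using (AllPairs; []; _∷_)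
import Data.List.Relation.Unary.AllPairs.Properties as AllPairs
open import Data.List.Relation.Unary.Any using (here)
import Data.List.Relation.Unary.Any.Properties as Any
open import Data.Nat as ℕ using (ℕ; zero; suc; _*_; _∸_; NonZero; s≤s; z≤n)
import Data.Nat.Properties as ℕ
import Data.Nat.Tactic.RingSolver as ℕ
open import Data.Product using (∃-syntax; _×_; _,_; proj₁; proj₂; swap)
open import Data.Sum using (_⊎_; inj₁; inj₂; [_,_])
open import Function using (_∘_; id)
open import Relation.Binary.PropositionalEquality using (_≡_; _≢_; refl; sym; trans; cong; cong₂; subst; subst₂)
open import Relation.Nullary using (contradiction)
open import Relation.Unary using (Pred; _∈_; _⊆_; ∅; _≐_; _⊥_; _∪_; _∖_; ｛_｝)

-- Tiled regions and gluing along partitions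

Tiled : Region → Set
Tiled P = ∃[ T ] AllPairs (λ s t → cells s ⊥ cells t) T × union T ≐ P

cover : ∀ {R D} → Tiled (R ∖ D) → HasCover R D
cover (T , disjoint , T≐) = T , record
  { disjoint  = disjoint
  ; contained = All.tabulate (λ t∈T c∈t → proj₁ T≐ (lose t∈T c∈t))
  ; covers    = T≐
  }

tiled-≐ : ∀ {P Q} → P ≐ Q → Tiled P → Tiled Q
tiled-≐ (P⊆Q , Q⊆P) (T , disjoint , T⊆P , P⊆T) = T , disjoint , P⊆Q ∘ T⊆P , P⊆T ∘ Q⊆P

tiled-empty : ∀ {P} → P ⊆ ∅ → Tiled P
tiled-empty empty = [] , [] , (λ ()) , λ c∈P → contradiction c∈P empty

tiled-tromino : ∀ d {r} → r ∈ block d → Tiled (block d ∖ ｛ r ｝)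
tiled-tromino d r∈ =
  record { corner = d ; removed∈block = r∈ } ∷ [] , [] ∷ [] , (λ { (here c∈) → c∈ }) , here

record Partition (R P Q : Region) : Set where
  constructor partition
  field
    disjoint : P ⊥ Q
    whole    : R ≐ P ∪ Q

open Partition

flip : ∀ {R P Q} → Partition R P Q → Partition R Q P
flip (partition P⊥Q (R⊆ , ⊆R)) =
  partition (P⊥Q ∘ swap) ([ inj₂ , inj₁ ] ∘ R⊆ , ⊆R ∘ [ inj₂ , inj₁ ])

puncture : ∀ {R P Q c} → c ∈ P → Partition R P Q → Partition (R ∖ ｛ c ｝) (P ∖ ｛ c ｝) Q
puncture c∈P (partition P⊥Q (R⊆ , ⊆R)) = partition
  (λ ((x∈P , _) , x∈Q) → P⊥Q (x∈P , x∈Q))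
  ( (λ (x∈R , c≢x) → [ (λ x∈P → inj₁ (x∈P , c≢x)) , inj₂ ] (R⊆ x∈R))
  , [ (λ (x∈P , c≢x) → ⊆R (inj₁ x∈P) , c≢x)
    , (λ x∈Q → ⊆R (inj₂ x∈Q) , λ { refl → P⊥Q (c∈P , x∈Q) }) ])

tiled-∪ : ∀ {R P Q} → Partition R P Q → Tiled P → Tiled Q → Tiled R
tiled-∪ (partition P⊥Q (R⊆ , ⊆R)) (S , S-disjoint , S⊆P , P⊆S) (T , T-disjoint , T⊆Q , Q⊆T) =
    S ++ T
  , AllPairs.++⁺ S-disjoint T-disjoint
      (All.tabulate λ s∈S → All.tabulate λ t∈T → λ (c∈s , c∈t) →
        P⊥Q (S⊆P (lose s∈S c∈s) , T⊆Q (lose t∈T c∈t)))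
  , ⊆R ∘ [ inj₁ ∘ S⊆P , inj₂ ∘ T⊆Q ] ∘ Any.++⁻ S
  , [ Any.++⁺ˡ ∘ P⊆S , Any.++⁺ʳ S ∘ Q⊆T ] ∘ R⊆

-- Two parallel cuts leave three slabs, and only the middle one feels the defect. This serves once
-- for rows and once for columns.
tiled-around : ∀ {R L R′ M H c} → Partition R L R′ → Partition R′ M H → c ∈ M →
               Tiled L → Tiled (M ∖ ｛ c ｝) → Tiled H → Tiled (R ∖ ｛ c ｝)
tiled-around R≐ R′≐ c∈M L M H =
  tiled-∪ (puncture (proj₂ (whole R′≐) (inj₁ c∈M)) (flip R≐)) (tiled-∪ (puncture c∈M R′≐) M H) L

-- Rotated coordinates and boxes

sum diff : Cell → ℤ
sum  (i , j) = i ℤ.+ j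
diff (i , j) = j ℤ.- i

-- The half-open interval from `α` to `α + m`. Storing the offset in `Fin m` lets small boxes be
-- treated by matching on literal offsets.
Interval : ℤ → ℕ → Pred ℤ _
Interval α m z = ∃[ p ] z ≡ α ℤ.+ + toℕ {m} p

-- A record rather than a product, so that α, m, β, n and c can be inferred.
record Box (α : ℤ) (m : ℕ) (β : ℤ) (n : ℕ) (c : Cell) : Set where
  constructor _,_
  field
    sum∈  : Interval α m (sum c)
    diff∈ : Interval β n (diff c)

interval-⊥ : ∀ α m n → Interval α m ⊥ Interval (α ℤ.+ + m) n
interval-⊥ α m n ((p , refl) , (q , eq)) = ℕ.<⇒≢ p<m+q (ℤ.+-injective (∙-cancelˡ α _ _ α+p≡α+[m+q]))
  where
  p<m+q : toℕ p ℕ.< m ℕ.+ toℕ q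
  p<m+q = ℕ.<-≤-trans (toℕ<n p) (ℕ.m≤m+n m (toℕ q))

  α+p≡α+[m+q] : α ℤ.+ + toℕ p ≡ α ℤ.+ + (m ℕ.+ toℕ q)
  α+p≡α+[m+q] = trans eq (ℤ.+-assoc α (+ m) (+ toℕ q))

interval-++ : ∀ α m n → Interval α (m ℕ.+ n) ≐ Interval α m ∪ Interval (α ℤ.+ + m) n
interval-++ α m n = to , [ fromˡ , fromʳ ]
  where
  to : Interval α (m ℕ.+ n) ⊆ Interval α m ∪ Interval (α ℤ.+ + m) n
  to (p , refl) with Fin.splitAt m p in eq
  ... | inj₁ q rewrite sym (splitAt⁻¹-↑ˡ eq) | toℕ-↑ˡ q n = inj₁ (q , refl)
  ... | inj₂ q rewrite sym (splitAt⁻¹-↑ʳ eq) | toℕ-↑ʳ m q =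
    inj₂ (q , sym (ℤ.+-assoc α (+ m) (+ toℕ q)))

  fromˡ : Interval α m ⊆ Interval α (m ℕ.+ n)
  fromˡ (q , refl) = q ↑ˡ n , cong (λ k → α ℤ.+ + k) (sym (toℕ-↑ˡ q n))

  fromʳ : Interval (α ℤ.+ + m) n ⊆ Interval α (m ℕ.+ n)
  fromʳ (q , refl) = m ↑ʳ q ,
    trans (ℤ.+-assoc α (+ m) (+ toℕ q)) (cong (λ k → α ℤ.+ + k) (sym (toℕ-↑ʳ m q)))

split-sum : ∀ {α β n} m m′ → Partition (Box α (m ℕ.+ m′) β n) (Box α m β n) (Box (α ℤ.+ + m) m′ β n)
split-sum {α} m m′ = partition
  (λ ((u , _) , (u′ , _)) → interval-⊥ α m m′ (u , u′))
  ( (λ (u , v) → [ (λ u → inj₁ (u , v)) , (λ u → inj₂ (u , v)) ] (proj₁ (interval-++ α m m′) u))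
  , [ (λ (u , v) → proj₂ (interval-++ α m m′) (inj₁ u) , v)
    , (λ (u , v) → proj₂ (interval-++ α m m′) (inj₂ u) , v) ])

split-diff : ∀ {α m β} n n′ → Partition (Box α m β (n ℕ.+ n′)) (Box α m β n) (Box α m (β ℤ.+ + n) n′)
split-diff {β = β} n n′ = partition
  (λ ((_ , v) , (_ , v′)) → interval-⊥ β n n′ (v , v′))
  ( (λ (u , v) → [ (λ v → inj₁ (u , v)) , (λ v → inj₂ (u , v)) ] (proj₁ (interval-++ β n n′) v))
  , [ (λ (u , v) → u , proj₂ (interval-++ β n n′) (inj₁ v))
    , (λ (u , v) → u , proj₂ (interval-++ β n n′) (inj₂ v)) ])

-- Recovering a cell from its rotated coordinates, and parity

sum+diff : ∀ i j → (i ℤ.+ j) ℤ.+ (j ℤ.- i) ≡ j ℤ.+ j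
sum+diff = solve-∀

double-injective : ∀ y z → y ℤ.+ y ≡ z ℤ.+ z → y ≡ z
double-injective y z eq = ℤ.*-cancelˡ-≡ (+ 2) y z (trans (twice y) (trans eq (sym (twice z))))
  where
  twice : ∀ x → + 2 ℤ.* x ≡ x ℤ.+ x
  twice = solve-∀

-- The two coordinates add up to twice `j`, which determines `j`; then `sum` determines `i`.
locate : ∀ {c} d → sum c ≡ sum d → diff c ≡ diff d → c ≡ d
locate {i , j} (i′ , j′) s≡ d≡ with refl ← double-injective j j′
  (trans (sym (sum+diff i j)) (trans (cong₂ ℤ._+_ s≡ d≡) (sum+diff i′ j′))) =
  cong (_, j) (∙-cancelʳ j i i′ s≡)

double-odd : ∀ y h → y ℤ.+ y ≢ h ℤ.+ h ℤ.+ 1ℤ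
double-odd y h eq = no (y ℤ.- h) (trans (lhs y h) (trans (cong (ℤ._- (h ℤ.+ h)) eq) (rhs h)))
  where
  no : ∀ z → z ℤ.+ z ≢ 1ℤ
  -- For zero and negative `z` the double already computes to something other than 1.
  no (+ suc n) eq with () ← trans (sym (ℕ.+-suc n n)) (ℕ.suc-injective (ℤ.+-injective eq))
  lhs : ∀ y h → (y ℤ.- h) ℤ.+ (y ℤ.- h) ≡ (y ℤ.+ y) ℤ.- (h ℤ.+ h)
  lhs = solve-∀
  rhs : ∀ h → h ℤ.+ h ℤ.+ 1ℤ ℤ.- (h ℤ.+ h) ≡ 1ℤ
  rhs = solve-∀

-- The 3 × 3 box that is a 2 × 2 block

sum-shift : ∀ x y i j → (i ℤ.+ x) ℤ.+ (j ℤ.+ y) ≡ i ℤ.+ j ℤ.+ (x ℤ.+ y)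
sum-shift = solve-∀

diff-shift : ∀ x y i j → (j ℤ.+ y) ℤ.- (i ℤ.+ x) ≡ j ℤ.- i ℤ.- 1ℤ ℤ.+ (1ℤ ℤ.+ y ℤ.- x)
diff-shift = solve-∀

-- The corner has odd coordinate sum `j + j - 1`, so it is not a cell. The cells of this box are the
-- midpoints of its four sides.
Around : Cell → Region
Around d = Box (sum d) 3 (diff d ℤ.- 1ℤ) 3

-- Offsets of even total from an odd corner would give `c` an odd coordinate sum, but that sum is
-- twice an integer.
no-cell : ∀ {c} d {p q} → sum c ≡ sum d ℤ.+ p → diff c ≡ diff d ℤ.- 1ℤ ℤ.+ q →
          ∀ h → p ℤ.+ q ≢ h ℤ.+ h
no-cell {i′ , j′} (i , j) {p} {q} s≡ d≡ h p+q≡h+h = double-odd j′ (j ℤ.+ h ℤ.- 1ℤ)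
  (trans (sym (sum+diff i′ j′)) (trans (cong₂ ℤ._+_ s≡ d≡)
    (trans (collect i j p q) (trans (cong (λ n → j ℤ.+ j ℤ.- 1ℤ ℤ.+ n) p+q≡h+h) (odd j h)))))
  where
  collect : ∀ i j p q → (i ℤ.+ j ℤ.+ p) ℤ.+ (j ℤ.- i ℤ.- 1ℤ ℤ.+ q) ≡ j ℤ.+ j ℤ.- 1ℤ ℤ.+ (p ℤ.+ q)
  collect = solve-∀
  odd : ∀ j h → j ℤ.+ j ℤ.- 1ℤ ℤ.+ (h ℤ.+ h) ≡ (j ℤ.+ h ℤ.- 1ℤ) ℤ.+ (j ℤ.+ h ℤ.- 1ℤ) ℤ.+ 1ℤ
  odd = solve-∀

pair≐interval : ∀ i → (λ x → x ≡ i ⊎ x ≡ i ℤ.+ 1ℤ) ≐ Interval i 2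
pair≐interval i =
    [ (λ eq → 0F , trans eq (sym (ℤ.+-identityʳ i))) , (1F ,_) ]
  , λ { (0F , eq) → inj₁ (trans eq (ℤ.+-identityʳ i)) ; (1F , eq) → inj₂ eq }

block≐Around : ∀ d → block d ≐ Around d
block≐Around d@(i , j) =
    (λ (x , y) → to (proj₁ (pair≐interval i) x , proj₁ (pair≐interval j) y))
  , (λ c∈ → let (x , y) = from c∈ in proj₂ (pair≐interval i) x , proj₂ (pair≐interval j) y)
  where
  Square : Region
  Square (x , y) = Interval i 2 x × Interval j 2 y

  to : Square ⊆ Around d
  to ((0F , refl) , (0F , refl)) = (0F , sum-shift 0ℤ 0ℤ i j) , (1F , diff-shift 0ℤ 0ℤ i j)
  to ((0F , refl) , (1F , refl)) = (1F , sum-shift 0ℤ 1ℤ i j) , (2F , diff-shift 0ℤ 1ℤ i j)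
  to ((1F , refl) , (0F , refl)) = (1F , sum-shift 1ℤ 0ℤ i j) , (0F , diff-shift 1ℤ 0ℤ i j)
  to ((1F , refl) , (1F , refl)) = (2F , sum-shift 1ℤ 1ℤ i j) , (1F , diff-shift 1ℤ 1ℤ i j)

  at : ∀ {c} x y → sum c ≡ sum d ℤ.+ (x ℤ.+ y) → diff c ≡ diff d ℤ.- 1ℤ ℤ.+ (1ℤ ℤ.+ y ℤ.- x) →
       c ≡ (i ℤ.+ x , j ℤ.+ y)
  at x y s≡ d≡ = locate _ (trans s≡ (sym (sum-shift x y i j))) (trans d≡ (sym (diff-shift x y i j)))

  from : Around d ⊆ Square
  from {c} ((0F , s≡) , (1F , d≡)) with refl ← at {c} 0ℤ 0ℤ s≡ d≡ = (0F , refl) , (0F , refl)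
  from {c} ((1F , s≡) , (2F , d≡)) with refl ← at {c} 0ℤ 1ℤ s≡ d≡ = (0F , refl) , (1F , refl)
  from {c} ((1F , s≡) , (0F , d≡)) with refl ← at {c} 1ℤ 0ℤ s≡ d≡ = (1F , refl) , (0F , refl)
  from {c} ((2F , s≡) , (1F , d≡)) with refl ← at {c} 1ℤ 1ℤ s≡ d≡ = (1F , refl) , (1F , refl)
  -- The other five pairs of offsets have an even total; the last argument is half of it.
  from {c} ((0F , s≡) , (0F , d≡)) = contradiction refl (no-cell {c} d s≡ d≡ 0ℤ)
  from {c} ((0F , s≡) , (2F , d≡)) = contradiction refl (no-cell {c} d s≡ d≡ 1ℤ)
  from {c} ((1F , s≡) , (1F , d≡)) = contradiction refl (no-cell {c} d s≡ d≡ 1ℤ)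
  from {c} ((2F , s≡) , (0F , d≡)) = contradiction refl (no-cell {c} d s≡ d≡ 1ℤ)
  from {c} ((2F , s≡) , (2F , d≡)) = contradiction refl (no-cell {c} d s≡ d≡ (+ 2))

-- Boxes covered by one tromino

tiled-Around : ∀ d {r} → r ∈ Around d → Tiled (Around d ∖ ｛ r ｝)
tiled-Around d r∈ = tiled-≐
  ( (λ (c∈ , r≢c) → proj₁ (block≐Around d) c∈ , r≢c)
  , (λ (c∈ , r≢c) → proj₂ (block≐Around d) c∈ , r≢c))
  (tiled-tromino d (proj₂ (block≐Around d) r∈))

-- Here `r` is the only cell of `Q`, so `P` is the block with `r` removed.
tiled-part : ∀ d {P Q} → Partition (Around d) P Q → ∀ r → r ∈ Q →
             (∀ c c′ → c ∈ Q → c′ ∈ Q → c ≡ c′) → Tiled P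
tiled-part d (partition P⊥Q (A⊆ , ⊆A)) r r∈Q unique = tiled-≐
  ( (λ (c∈A , r≢c) → [ id , (λ c∈Q → contradiction (unique r _ r∈Q c∈Q) r≢c) ] (A⊆ c∈A))
  , (λ c∈P → ⊆A (inj₁ c∈P) , λ { refl → P⊥Q (c∈P , r∈Q) }))
  (tiled-Around d (⊆A (inj₂ r∈Q)))

-- In a row at even offset `h + h`, both end positions have even total offset, so only the middle
-- one is a cell. The bottom row is `h = 0`, the top row `h = 1`.
row-unique : ∀ d h {γ} → γ ≡ diff d ℤ.- 1ℤ ℤ.+ (h ℤ.+ h) →
             ∀ c c′ → c ∈ Box (sum d) 3 γ 1 → c′ ∈ Box (sum d) 3 γ 1 → c ≡ c′
row-unique d h {γ} γ≡ c c′ c∈@(_ , (0F , d≡)) c′∈@(_ , (0F , d≡′)) =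
  locate _ (trans (middle {c} c∈) (sym (middle {c′} c′∈))) (trans d≡ (sym d≡′))
  where
  next : ∀ h → + 2 ℤ.+ (h ℤ.+ h) ≡ (h ℤ.+ 1ℤ) ℤ.+ (h ℤ.+ 1ℤ)
  next = solve-∀

  middle : ∀ {c} → c ∈ Box (sum d) 3 γ 1 → sum c ≡ sum d ℤ.+ 1ℤ
  middle {c} ((0F , s≡) , (0F , d≡)) =
    contradiction (ℤ.+-identityˡ (h ℤ.+ h)) (no-cell {c} d s≡ (trans d≡ (trans (ℤ.+-identityʳ γ) γ≡)) h)
  middle {c} ((1F , s≡) , _) = s≡
  middle {c} ((2F , s≡) , (0F , d≡)) =
    contradiction (next h) (no-cell {c} d s≡ (trans d≡ (trans (ℤ.+-identityʳ γ) γ≡)) (h ℤ.+ 1ℤ))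

column-unique : ∀ d h {γ} → γ ≡ sum d ℤ.+ (h ℤ.+ h) →
                ∀ c c′ → c ∈ Box γ 1 (diff d ℤ.- 1ℤ) 3 → c′ ∈ Box γ 1 (diff d ℤ.- 1ℤ) 3 → c ≡ c′
column-unique d h {γ} γ≡ c c′ c∈@((0F , s≡) , _) c′∈@((0F , s≡′) , _) =
  locate _ (trans s≡ (sym s≡′)) (trans (middle {c} c∈) (sym (middle {c′} c′∈)))
  where
  next : ∀ h → (h ℤ.+ h) ℤ.+ + 2 ≡ (h ℤ.+ 1ℤ) ℤ.+ (h ℤ.+ 1ℤ)
  next = solve-∀

  middle : ∀ {c} → c ∈ Box γ 1 (diff d ℤ.- 1ℤ) 3 → diff c ≡ diff d ℤ.- 1ℤ ℤ.+ 1ℤ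
  middle {c} ((0F , s≡) , (0F , d≡)) =
    contradiction (ℤ.+-identityʳ (h ℤ.+ h)) (no-cell {c} d (trans s≡ (trans (ℤ.+-identityʳ γ) γ≡)) d≡ h)
  middle (_ , (1F , d≡)) = d≡
  middle {c} ((0F , s≡) , (2F , d≡)) =
    contradiction (next h) (no-cell {c} d (trans s≡ (trans (ℤ.+-identityʳ γ) γ≡)) d≡ (h ℤ.+ 1ℤ))

-- This box and the next three arise from `Around d` by dropping an outer row or column, which holds
-- one cell of the block. Together they give both orientations with both corner parities.
bottom-3×2 : ∀ d → Tiled (Box (sum d) 3 (diff d ℤ.- 1ℤ) 2)
bottom-3×2 d@(i , j) = tiled-part d (split-diff 2 1) (i ℤ.+ 0ℤ , j ℤ.+ 1ℤ)
  ((1F , sum-shift 0ℤ 1ℤ i j) , (0F , trans (diff-shift 0ℤ 1ℤ i j) (sym (ℤ.+-identityʳ _))))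
  (row-unique d 1ℤ refl)

top-3×2 : ∀ d → Tiled (Box (sum d) 3 (diff d ℤ.- 1ℤ ℤ.+ 1ℤ) 2)
top-3×2 d@(i , j) = tiled-part d (flip (split-diff 1 2)) (i ℤ.+ 1ℤ , j ℤ.+ 0ℤ)
  ((1F , sum-shift 1ℤ 0ℤ i j) , (0F , diff-shift 1ℤ 0ℤ i j))
  (row-unique d 0ℤ (sym (ℤ.+-identityʳ _)))

left-2×3 : ∀ d → Tiled (Box (sum d) 2 (diff d ℤ.- 1ℤ) 3)
left-2×3 d@(i , j) = tiled-part d (split-sum 2 1) (i ℤ.+ 1ℤ , j ℤ.+ 1ℤ)
  ((0F , trans (sum-shift 1ℤ 1ℤ i j) (sym (ℤ.+-identityʳ _))) , (1F , diff-shift 1ℤ 1ℤ i j))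
  (column-unique d 1ℤ refl)

right-2×3 : ∀ d → Tiled (Box (sum d ℤ.+ 1ℤ) 2 (diff d ℤ.- 1ℤ) 3)
right-2×3 d@(i , j) = tiled-part d (flip (split-sum 1 2)) (i ℤ.+ 0ℤ , j ℤ.+ 0ℤ)
  ((0F , sum-shift 0ℤ 0ℤ i j) , (1F , diff-shift 0ℤ 0ℤ i j))
  (column-unique d 0ℤ (sym (ℤ.+-identityʳ _)))

-- Odd numbers take the form `h + h - 1` so that `h` can be passed to `corner` as the second
-- coordinate of the cell.
even⊎odd : ∀ z → ∃[ h ] (z ≡ h ℤ.+ h ⊎ z ≡ h ℤ.+ h ℤ.- 1ℤ)
even⊎odd z with z %ℕ 2 | n%ℕd<d z 2 | a≡a%ℕn+[a/ℕn]*n z 2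
... | 0 | _ | z≡ = z /ℕ 2 , inj₁ (trans z≡ (even (z /ℕ 2)))
  where
  even : ∀ h → 0ℤ ℤ.+ h ℤ.* + 2 ≡ h ℤ.+ h
  even = solve-∀
... | 1 | _ | z≡ = z /ℕ 2 ℤ.+ 1ℤ , inj₂ (trans z≡ (odd (z /ℕ 2)))
  where
  odd : ∀ h → 1ℤ ℤ.+ h ℤ.* + 2 ≡ (h ℤ.+ 1ℤ) ℤ.+ (h ℤ.+ 1ℤ) ℤ.- 1ℤ
  odd = solve-∀
... | suc (suc _) | s≤s (s≤s ()) | _

-- Adding the equations `i + j = α` and `j - i - 1 = β` yields the hypothesis on `j`; the first one
-- then gives `i = α - j`.
corner : ∀ α β j → α ℤ.+ β ≡ j ℤ.+ j ℤ.- 1ℤ → ∃[ d ] (sum d ≡ α × diff d ℤ.- 1ℤ ≡ β)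
corner α β j eq = (α ℤ.- j , j) , cancel α j ,
  trans (regroup α j) (trans (cong (ℤ._- α) (sym eq)) (cancel′ α β))
  where
  cancel : ∀ α j → (α ℤ.- j) ℤ.+ j ≡ α
  cancel = solve-∀
  regroup : ∀ α j → j ℤ.- (α ℤ.- j) ℤ.- 1ℤ ≡ j ℤ.+ j ℤ.- 1ℤ ℤ.- α
  regroup = solve-∀
  cancel′ : ∀ α β → α ℤ.+ β ℤ.- α ≡ β
  cancel′ = solve-∀

pred+1 : ∀ α → α ℤ.- 1ℤ ℤ.+ 1ℤ ≡ α
pred+1 = solve-∀

tiled-3×2 : ∀ α β → Tiled (Box α 3 β 2)
tiled-3×2 α β with even⊎odd (α ℤ.+ β)
... | j , inj₂ odd =
  let d , s≡ , d≡ = corner α β j odd in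
  subst₂ (λ α β → Tiled (Box α 3 β 2)) s≡ d≡ (bottom-3×2 d)
... | j , inj₁ even =
  -- Moving the corner down one row makes its parity odd; the wanted box is the upper part of that
  -- `Around d`.
  let d , s≡ , d≡ = corner α (β ℤ.- 1ℤ) j (trans (associate α β) (cong (ℤ._- 1ℤ) even)) in
  subst₂ (λ α β → Tiled (Box α 3 β 2)) s≡ (trans (cong (ℤ._+ 1ℤ) d≡) (pred+1 β)) (top-3×2 d)
  where
  associate : ∀ α β → α ℤ.+ (β ℤ.- 1ℤ) ≡ α ℤ.+ β ℤ.- 1ℤ
  associate = solve-∀

tiled-2×3 : ∀ α β → Tiled (Box α 2 β 3)
tiled-2×3 α β with even⊎odd (α ℤ.+ β)
... | j , inj₂ odd =
  let d , s≡ , d≡ = corner α β j odd in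
  subst₂ (λ α β → Tiled (Box α 2 β 3)) s≡ d≡ (left-2×3 d)
... | j , inj₁ even =
  let d , s≡ , d≡ = corner (α ℤ.- 1ℤ) β j (trans (commute α β) (cong (ℤ._- 1ℤ) even)) in
  subst₂ (λ α β → Tiled (Box α 2 β 3)) (trans (cong (ℤ._+ 1ℤ) s≡) (pred+1 α)) d≡ (right-2×3 d)
  where
  commute : ∀ α β → α ℤ.- 1ℤ ℤ.+ β ≡ α ℤ.+ β ℤ.- 1ℤ
  commute = solve-∀

-- Larger boxes and the punctured box

tiled-3q×2 : ∀ q {α β} → Tiled (Box α (q * 3) β 2)
tiled-3q×2 zero    = tiled-empty λ { ((() , _) , _) }
tiled-3q×2 (suc q) = tiled-∪ (split-sum 3 (q * 3)) (tiled-3×2 _ _) (tiled-3q×2 q)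

tiled-3q×2n : ∀ q n {α β} → Tiled (Box α (q * 3) β (n * 2))
tiled-3q×2n q zero    = tiled-empty λ { (_ , (() , _)) }
tiled-3q×2n q (suc n) = tiled-∪ (split-diff 2 (n * 2)) (tiled-3q×2 q) (tiled-3q×2n q n)

tiled-2n×3 : ∀ n {α β} → Tiled (Box α (n * 2) β 3)
tiled-2n×3 zero    = tiled-empty λ { ((() , _) , _) }
tiled-2n×3 (suc n) = tiled-∪ (split-sum 2 (n * 2)) (tiled-2×3 _ _) (tiled-2n×3 n)

-- Windows of length 3 starting at even offsets cover an interval of odd length, neighbours sharing
-- an endpoint. An even length remains on either side.
window : ∀ α n {z} → Interval α (2 * suc n ℕ.+ 1) z →
         ∃[ m ] ∃[ m′ ] (2 * suc n ℕ.+ 1 ≡ m * 2 ℕ.+ (3 ℕ.+ m′ * 2) × Interval (α ℤ.+ + (m * 2)) 3 z)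
window α n (p , refl) = let m , m′ , q , n≡ , p≡ = go n (toℕ p) (toℕ<n p) in
  m , m′ , n≡ , q , trans (cong (λ k → α ℤ.+ + k) p≡) (sym (ℤ.+-assoc α (+ (m * 2)) (+ toℕ q)))
  where
  first : ∀ n → 2 * suc n ℕ.+ 1 ≡ 3 ℕ.+ n * 2
  first = ℕ.solve-∀

  go : ∀ n p → p ℕ.< 2 * suc n ℕ.+ 1 →
       ∃[ m ] ∃[ m′ ] ∃[ q ] (2 * suc n ℕ.+ 1 ≡ m * 2 ℕ.+ (3 ℕ.+ m′ * 2) × p ≡ m * 2 ℕ.+ toℕ {3} q)
  go n 0 _ = 0 , n , 0F , first n , refl
  go n 1 _ = 0 , n , 1F , first n , refl
  go n 2 _ = 0 , n , 2F , first n , refl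
  go zero (suc (suc (suc p))) (s≤s (s≤s (s≤s ())))
  -- Offsets from 3 on are moved back by 2, one window; offset 2 was assigned to the first window.
  go (suc n) (suc (suc p@(suc _))) p< = let m , m′ , q , n≡ , p≡ = go n p p<′ in
    suc m , m′ , q , trans (eq n) (cong (2 ℕ.+_) n≡) , cong (2 ℕ.+_) p≡
    where
    eq : ∀ n → 2 * suc (suc n) ℕ.+ 1 ≡ 2 ℕ.+ (2 * suc n ℕ.+ 1)
    eq = ℕ.solve-∀
    p<′ : p ℕ.< 2 * suc n ℕ.+ 1
    p<′ = ℕ.+-cancelˡ-< 2 p _ (subst (2 ℕ.+ p ℕ.<_) (eq n) p<)

tiled-punctured-box : ∀ a b q → 2 * suc b ℕ.+ 1 ≡ q * 3 →
                      ∀ {c} → c ∈ Box 0ℤ (2 * suc b ℕ.+ 1) 1ℤ (2 * suc a ℕ.+ 1) →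
                      Tiled (Box 0ℤ (2 * suc b ℕ.+ 1) 1ℤ (2 * suc a ℕ.+ 1) ∖ ｛ c ｝)
tiled-punctured-box a b q 3∣ {c} (u , v)
  with m , m′ , m≡ , u′ ← window 0ℤ b u | n , n′ , n≡ , v′ ← window 1ℤ a v =
  -- Only the height is split here: the full width is kept for `rows`, which uses that it is a
  -- multiple of 3, and `row` splits it afterwards.
  subst (λ k → Tiled (Box 0ℤ (2 * suc b ℕ.+ 1) 1ℤ k ∖ ｛ c ｝)) (sym n≡)
    (tiled-around (split-diff (n * 2) _) (split-diff 3 (n′ * 2)) (u , v′)
      (rows n) row (rows n′))
  where
  rows : ∀ n {β} → Tiled (Box 0ℤ (2 * suc b ℕ.+ 1) β (n * 2))
  rows n {β} = subst (λ k → Tiled (Box 0ℤ k β (n * 2))) (sym 3∣) (tiled-3q×2n q n)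

  centre : Tiled (Box (+ (m * 2)) 3 (1ℤ ℤ.+ + (n * 2)) 3 ∖ ｛ c ｝)
  centre =
    -- The window corner is `(2m , 1 + 2n)`, with odd sum `2(m + n + 1) - 1`.
    let d , s≡ , d≡ = corner (+ (m * 2)) (1ℤ ℤ.+ + (n * 2)) (+ suc (m ℕ.+ n)) (cong +_ (eq m n)) in
    subst₂ (λ α β → c ∈ Box α 3 β 3 → Tiled (Box α 3 β 3 ∖ ｛ c ｝)) s≡ d≡ (tiled-Around d) (u′ , v′)
    where
    eq : ∀ m n → m * 2 ℕ.+ (1 ℕ.+ n * 2) ≡ m ℕ.+ n ℕ.+ suc (m ℕ.+ n)
    eq = ℕ.solve-∀

  row : Tiled (Box 0ℤ (2 * suc b ℕ.+ 1) (1ℤ ℤ.+ + (n * 2)) 3 ∖ ｛ c ｝)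
  row = subst (λ k → Tiled (Box 0ℤ k (1ℤ ℤ.+ + (n * 2)) 3 ∖ ｛ c ｝)) (sym m≡)
    (tiled-around (split-sum (m * 2) _) (split-sum 3 (m′ * 2)) (u′ , v′)
      (tiled-2n×3 m) centre (tiled-2n×3 m′))

-- The Aztec rectangle as a box

aztec≐box : ∀ a b → AztecRectangle a b ≐ Box 0ℤ (2 * b ℕ.+ 1) 1ℤ (2 * a ℕ.+ 1)
aztec≐box a b =
    (λ (u , v) → rise u , climb v)
  , (λ (u , v) → fall u , descend v)
  where
  rise : ∀ {z} → 0ℤ ℤ.≤ z × z ℤ.≤ + (2 * b) → Interval 0ℤ (2 * b ℕ.+ 1) z
  rise {+ p} (_ , +≤+ p≤) = fromℕ< p< , cong +_ (sym (toℕ-fromℕ< p<))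
    where
    p< : p ℕ.< 2 * b ℕ.+ 1
    p< = subst (p ℕ.<_) (ℕ.+-comm 1 (2 * b)) (s≤s p≤)

  fall : ∀ {z} → Interval 0ℤ (2 * b ℕ.+ 1) z → 0ℤ ℤ.≤ z × z ℤ.≤ + (2 * b)
  fall (p , refl) = +≤+ z≤n , +≤+ (ℕ.s≤s⁻¹ (subst (toℕ p ℕ.<_) (ℕ.+-comm (2 * b) 1) (toℕ<n p)))

  climb : ∀ {z} → 1ℤ ℤ.≤ z × z ℤ.≤ + (2 * a ℕ.+ 1) → Interval 1ℤ (2 * a ℕ.+ 1) z
  climb {+ suc p} (_ , +≤+ p<) = fromℕ< p< , cong (λ k → + suc k) (sym (toℕ-fromℕ< p<))
  climb {+ 0} (+≤+ () , _)

  descend : ∀ {z} → Interval 1ℤ (2 * a ℕ.+ 1) z → 1ℤ ℤ.≤ z × z ℤ.≤ + (2 * a ℕ.+ 1)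
  descend (p , refl) = +≤+ (s≤s z≤n) , +≤+ (toℕ<n p)

3k∸2 : ∀ k → 3 * suc k ∸ 2 ≡ suc (3 * k)
3k∸2 k = cong (_∸ 2) (ℕ.*-suc 3 k)

theorem2 : (k l : ℕ) .{{_ : NonZero k}} .{{_ : NonZero l}} →
    (c : Cell) → c ∈ AztecRectangle (3 * k ∸ 2) (3 * l ∸ 2) →
    HasCover (AztecRectangle (3 * k ∸ 2) (3 * l ∸ 2)) ｛ c ｝
theorem2 (suc k) (suc l) c rewrite 3k∸2 k | 3k∸2 l = λ c∈ →
  let AR⊆ , ⊆AR = aztec≐box (suc (3 * k)) (suc (3 * l)) in
  cover (tiled-≐ ((λ (x∈ , c≢x) → ⊆AR x∈ , c≢x) , (λ (x∈ , c≢x) → AR⊆ x∈ , c≢x))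
    -- After matching, `l` is one less than in the statement, so `b = 3l + 1` and the width is
    -- `2b + 1 = 3(2l + 1)`.
    (tiled-punctured-box (3 * k) (3 * l) (2 * l ℕ.+ 1) (eq l) (AR⊆ c∈)))
  where
  eq : ∀ l → 2 * suc (3 * l) ℕ.+ 1 ≡ (2 * l ℕ.+ 1) * 3
  eq = ℕ.solve-∀
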